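{- Let $\mathcal{G}=(V,E,\lambda)$ be a happy compressed temporal graph that is temporally connected. If $\mathcal{G}$ has exactly one divergent edge, then this edge is a pivot edge. Likewise, if $\mathcal{G}$ has exactly one convergent edge, then this edge is a pivot edge.
   Context: A happy temporal graph is a triple $\mathcal{G}=(V,E,\lambda)$ where $(V,E)$ is a finite simple undirected graph (the footprint) and $\lambda:E\to\{1,2,3,\dots\}$ assigns a single time label to each edge, such that two distinct edges sharing an endpoint have different labels. It is compressed if for every edge $e$ with $\lambda(e)>1$ there is an edge $e'$ adjacent to $e$ with $\lambda(e')=\lambda(e)-1$. A temporal walk is a walk in the footprint along which edge labels are strictly increasing (so no edge is repeated); the empty walk is allowed. For vertices $u,v$ and edges $e,e'$: $u\leadsto v$ means there is a temporal walk from $u$ to $v$; $v\leadsto e$ means some temporal walk starts at $v$ and traverses $e$; $e\leadsto v$ means some temporal walk traverses $e$ and ends at $v$; $e\leadsto e'$ means some temporal walk traverses $e$ and $e'$ in this order, not necessarily consecutively (with $e\leadsto e$ always). Edges may be traversed in either direction. $\mathcal{G}$ is temporally connected if $u\leadsto v$ for all $u,v\in V$. An edge $e$ is a source edge if $e\leadsto v$ for all $v\in V$, a sink edge if $v\leadsto e$ for all $v\in V$, and a pivot edge if it is both. A divergent edge is a source edge $e$ such that there is no other source edge $e'\neq e$ with $e\leadsto e'$. A div-sink edge is a sink edge $e$ such that $d\leadsto e$ for every divergent edge $d$. A convergent edge is a div-sink edge $e$ such that there is no other div-sink edge $e'\ne e$ with $e'\leadsto e$. -}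

module Defs where

open import Data.Fin.Base using (Fin)
open import Data.List.Base using (List; []; _∷_)
open import Data.List.Membership.Propositional using (_∈_)
open import Data.List.Relation.Binary.Sublist.Propositional using (_⊆_)
open import Data.List.Relation.Unary.Linked using (Linked)
open import Data.Nat.Base using (ℕ; _∸_; _≤_; _<_)
open import Data.Product.Base using (_×_; _,_; proj₁; proj₂; ∃; ∃-syntax)
open import Data.Sum.Base using (_⊎_)
open import Relation.Binary.PropositionalEquality.Core using (_≡_; _≢_)
open import Relation.Nullary.Negation.Core using (¬_)

-- The order of the two components of `endpoints e` carries no meaning: edges
-- are only ever inspected through `Joins`, which is symmetric in u and v.
record SimpleGraph : Set where
  field
    #vertices : ℕ
    #edges    : ℕ

  Vertex : Set
  Vertex = Fin #vertices

  Edge : Set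
  Edge = Fin #edges

  field
    endpoints : Edge → Vertex × Vertex

  Joins : Edge → Vertex → Vertex → Set
  Joins e u v = endpoints e ≡ (u , v) ⊎ endpoints e ≡ (v , u)

  field
    loopless    : ∀ e → proj₁ (endpoints e) ≢ proj₂ (endpoints e)
    no-parallel : ∀ {e e′ u v} → Joins e u v → Joins e′ u v → e ≡ e′

  _isEndpointOf_ : Vertex → Edge → Set
  v isEndpointOf e = ∃[ u ] Joins e u v

  Adjacent : Edge → Edge → Set
  Adjacent e e′ = e ≢ e′ × ∃[ v ] (v isEndpointOf e × v isEndpointOf e′)

  data Walk : Vertex → Vertex → Set where
    empty : ∀ {v} → Walk v v
    step  : ∀ {u v w} (e : Edge) → Joins e u v → Walk v w → Walk u w

  edges : ∀ {u v} → Walk u v → List Edge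
  edges empty        = []
  edges (step e _ p) = e ∷ edges p

record HappyTemporalGraph : Set where
  field
    footprint : SimpleGraph

  open SimpleGraph footprint public

  field
    label          : Edge → ℕ
    label-positive : ∀ e → 1 ≤ label e
    happy          : ∀ {e e′} → Adjacent e e′ → label e ≢ label e′

module _ (G : HappyTemporalGraph) where
  open HappyTemporalGraph G

  Compressed : Set
  Compressed = ∀ e → 1 < label e → ∃[ e′ ] (Adjacent e′ e × label e′ ≡ label e ∸ 1)

  Temporal : ∀ {u v} → Walk u v → Set
  Temporal p = Linked (λ e e′ → label e < label e′) (edges p)

  _v⤳v_ : Vertex → Vertex → Set
  u v⤳v v = ∃ λ (p : Walk u v) → Temporal p

  _v⤳e_ : Vertex → Edge → Set
  v v⤳e e = ∃[ w ] ∃ λ (p : Walk v w) → Temporal p × e ∈ edges p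

  _e⤳v_ : Edge → Vertex → Set
  e e⤳v v = ∃[ u ] ∃ λ (p : Walk u v) → Temporal p × e ∈ edges p

  -- `_⊆_` is the order-preserving sublist relation, so the second alternative
  -- says that p traverses e and, at some later position, e′.
  _e⤳e_ : Edge → Edge → Set
  e e⤳e e′ =
    e ≡ e′ ⊎
    (∃[ u ] ∃[ v ] ∃ λ (p : Walk u v) → Temporal p × (e ∷ e′ ∷ []) ⊆ edges p)

  TemporallyConnected : Set
  TemporallyConnected = ∀ u v → u v⤳v v

  Source : Edge → Set
  Source e = ∀ v → e e⤳v v

  Sink : Edge → Set
  Sink e = ∀ v → v v⤳e e

  Pivot : Edge → Set
  Pivot e = Source e × Sink e

  Divergent : Edge → Set
  Divergent e = Source e × ¬ (∃[ e′ ] (Source e′ × e′ ≢ e × e e⤳e e′))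

  DivSink : Edge → Set
  DivSink e = Sink e × (∀ d → Divergent d → d e⤳e e)

  Convergent : Edge → Set
  Convergent e = DivSink e × ¬ (∃[ e′ ] (DivSink e′ × e′ ≢ e × e′ e⤳e e))

{-# OPTIONS --safe #-}

-- The edge with the smallest label at a vertex v can be prepended to every
-- temporal walk leaving v, so by temporal connectivity it is a source edge.
-- From a source edge e with v ⤳ e that is not divergent one passes to a later
-- source edge e′, and v ⤳ e ⤳ e′ composes to v ⤳ e′ (if the two walks cross e in
-- opposite directions, e is simply skipped).  Labels increase, so this ends at
-- the unique divergent edge, which is therefore reached from every v.
-- Dually, the edge with the largest label at v can be appended to every temporal
-- walk arriving at v, which makes it a div-sink edge, and one descends from it to
-- the unique convergent edge.  The descents are classical; they are justified
-- because reachability is decidable, hence stable under double negation.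
module Submission where

open import Data.Fin.Base using (Fin; zero; suc)
import Data.Fin.Properties as Fin
open import Data.Fin.Induction using (spo-noetherian; spo-wellFounded)
open import Data.List.Base using (List; []; _∷_; _++_; allFin; filter; length; lookup)
open import Data.List.Extrema.Nat
  using (argmin; argmax; argmin-all; argmax-all; f[argmin]≤f[xs]; f[xs]≤f[argmax])
open import Data.List.Membership.DecPropositional using (_∈?_)
open import Data.List.Membership.Propositional using (_∈_)
open import Data.List.Membership.Propositional.Properties
  using (∈-allFin; ∈-filter⁺; ∈-lookup; ∈-++⁻)
open import Data.List.Relation.Binary.Sublist.Propositional
  using (_⊆_; []; _∷_; _∷ʳ_; ⊆-refl; ⊆-reflexive; ⊆-trans; from∈; to∈)
  renaming (lookup to ⊆-lookup)
open import Data.List.Relation.Binary.Sublist.Propositional.Properties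
  using (++⁺; ++⁺ˡ; ++⁺ʳ)
open import Data.List.Relation.Unary.All as All using (All; []; _∷_)
import Data.List.Relation.Unary.All.Properties as All
open import Data.List.Relation.Unary.AllPairs as AllPairs using (AllPairs; []; _∷_)
import Data.List.Relation.Unary.AllPairs.Properties as AllPairs
open import Data.List.Relation.Unary.Any using (here)
open import Data.List.Relation.Unary.Linked using ([-]; _∷_; linked?)
open import Data.List.Relation.Unary.Linked.Properties using (Linked⇒AllPairs; AllPairs⇒Linked)
open import Data.List.Relation.Unary.Unique.Propositional using (Unique)
open import Data.Nat.Base using (ℕ; zero; suc; _≤_; _<_; z≤n; s≤s; s≤s⁻¹)
import Data.Nat.Properties as ℕ
open import Data.Product using (_×_; _,_; proj₁; proj₂; ∃; ∃!; ∃-syntax)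
open import Data.Product.Properties using (≡-dec)
open import Data.Sum using (_⊎_; inj₁; inj₂; swap)
open import Function.Base using (_∘_; _on_; flip)
open import Induction.WellFounded using (WellFounded; Acc; acc)
open import Relation.Binary.Core using (Rel)
import Relation.Binary.Construct.On as On
open import Relation.Binary.PropositionalEquality
  using (_≡_; _≢_; refl; sym; cong; subst)
open import Relation.Nullary
  using (¬_; Dec; yes; no; contradiction; map′; decidable-stable; _×-dec_; _⊎-dec_)
open import Relation.Unary using (Pred; Decidable)
open import Level using (0ℓ)
open import Defs

-- Finite sets: duplicate-free lists, extrema, descent

lookup-injective : ∀ {A : Set} {xs : List A} → Unique xs →
  ∀ {i j} → lookup xs i ≡ lookup xs j → i ≡ j
lookup-injective (_ ∷ _)      {zero}  {zero}  _  = refl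
lookup-injective (x∉xs ∷ _)   {zero}  {suc j} eq = contradiction eq (All.lookup x∉xs (∈-lookup j))
lookup-injective (x∉xs ∷ _)   {suc i} {zero}  eq = contradiction (sym eq) (All.lookup x∉xs (∈-lookup i))
lookup-injective (_ ∷ unique) {suc _} {suc _} eq = cong suc (lookup-injective unique eq)

Unique⇒length≤ : ∀ {n} {xs : List (Fin n)} → Unique xs → length xs ≤ n
Unique⇒length≤ unique = Fin.injective⇒≤ (lookup-injective unique)

module _ {n} {P : Pred (Fin n) 0ℓ} (P? : Decidable P) (f : Fin n → ℕ) where

  private
    satisfying : List (Fin n)
    satisfying = filter P? (allFin n)

    ∈-satisfying : ∀ {y} → P y → y ∈ satisfying
    ∈-satisfying {y} = ∈-filter⁺ P? (∈-allFin y)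

  minimiser : ∃ P → ∃[ x ] (P x × ∀ {y} → P y → f x ≤ f y)
  minimiser (x , px) =
    argmin f x satisfying ,
    argmin-all f px (All.all-filter P? (allFin n)) ,
    λ py → All.lookup (f[argmin]≤f[xs] x satisfying) (∈-satisfying py)

  maximiser : ∃ P → ∃[ x ] (P x × ∀ {y} → P y → f y ≤ f x)
  maximiser (x , px) =
    argmax f x satisfying ,
    argmax-all f px (All.all-filter P? (allFin n)) ,
    λ py → All.lookup (f[xs]≤f[argmax] x satisfying) (∈-satisfying py)

-- Whether a smaller `y` with `Q y` exists is not decided, so the descent is run as a refutation:
-- under `¬ B`, no minimal element of `Q` can exist, and well-founded induction empties `Q`.
¬¬-minimal : ∀ {A B : Set} {_⊏_ : Rel A 0ℓ} {Q : Pred A 0ℓ} → WellFounded _⊏_ →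
  (∀ {x} → Q x → ¬ (∃[ y ] (Q y × y ⊏ x)) → B) →
  ∀ {x} → Q x → ¬ ¬ B
¬¬-minimal {_⊏_ = _⊏_} {Q} wf minimal⇒B {x} qx ¬b = go (wf x) qx
  where
  go : ∀ {x} → Acc _⊏_ x → ¬ Q x
  go (acc rs) qx = ¬b (minimal⇒B qx λ (_ , qy , y⊏x) → go (rs y⊏x) qy)

module _ (G : HappyTemporalGraph) where
  open HappyTemporalGraph G

  private
    variable
      u v w x : Vertex
      e e′ f : Edge
      xs ys : List Edge

  _≺_ : Rel Edge 0ℓ
  _≺_ = _<_ on label

  ≺-wellFounded : WellFounded _≺_
  ≺-wellFounded = spo-wellFounded (On.isStrictPartialOrder label ℕ.<-isStrictPartialOrder)

  ≺-noetherian : WellFounded (flip _≺_)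
  ≺-noetherian = spo-noetherian (On.isStrictPartialOrder label ℕ.<-isStrictPartialOrder)

  ≤∧≢⇒≺ : v isEndpointOf e → v isEndpointOf e′ → label e ≤ label e′ → e ≢ e′ → e ≺ e′
  ≤∧≢⇒≺ v∈e v∈e′ e≤e′ e≢e′ = ℕ.≤∧≢⇒< e≤e′ (happy (e≢e′ , _ , v∈e , v∈e′))

  -- Decidability of reachability

  joins? : ∀ e u v → Dec (Joins e u v)
  joins? e u v = ends ≟ (u , v) ⊎-dec ends ≟ (v , u)
    where
    ends = endpoints e
    _≟_ = ≡-dec Fin._≟_ Fin._≟_

  isEndpointOf? : ∀ v e → Dec (v isEndpointOf e)
  isEndpointOf? v e = Fin.any? λ u → joins? e u v

  -- The property concerns the edge list alone, so a first edge `e` is absorbed into it as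
  -- `P? ∘ (e ∷_)` and the search recurses on the bound.
  shortWalk? : ∀ n {P : Pred (List Edge) 0ℓ} → Decidable P → ∀ u v →
    Dec (∃ λ (p : Walk u v) → length (edges p) < n × P (edges p))
  shortWalk? zero P? u v = no λ ()
  shortWalk? (suc n) {P} P? u v = map′ to from
    (u Fin.≟ v ×-dec P? [] ⊎-dec
     Fin.any? λ e → Fin.any? λ w → joins? e u w ×-dec shortWalk? n (P? ∘ (e ∷_)) w v)
    where
    to : _ → ∃ λ (p : Walk u v) → length (edges p) < suc n × P (edges p)
    to (inj₁ (refl , p[]))                 = empty , s≤s z≤n , p[]
    to (inj₂ (e , w , j , p , p<n , pes)) = step e j p , s≤s p<n , pes

    from : (∃ λ (p : Walk u v) → length (edges p) < suc n × P (edges p)) → _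
    from (empty , _ , p[])        = inj₁ (refl , p[])
    from (step e j p , p<n , pes) = inj₂ (e , _ , j , p , s≤s⁻¹ p<n , pes)

  Increasing : List Edge → Set
  Increasing = AllPairs _≺_

  increasing : {p : Walk u v} → Temporal G p → Increasing (edges p)
  increasing = Linked⇒AllPairs ℕ.<-trans

  temporalWalkVia? : ∀ e u v → Dec (∃ λ (p : Walk u v) → Temporal G p × e ∈ edges p)
  temporalWalkVia? e u v = map′
    (λ (p , _ , via) → p , via)
    -- Increasing labels make the edges of `p` distinct, so there are at most `#edges` of them; the
    -- bound is strict, hence `suc #edges`.
    (λ (p , temporal , e∈p) →
       p , s≤s (Unique⇒length≤ (AllPairs.map distinct (increasing {p = p} temporal))) , temporal , e∈p)
    (shortWalk? (suc #edges)
      (λ es → linked? (λ e e′ → label e ℕ.<? label e′) es ×-dec _∈?_ Fin._≟_ e es) u v)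
    where
    distinct : ∀ {f g} → f ≺ g → f ≢ g
    distinct f≺g refl = ℕ.<-irrefl refl f≺g

  v⤳e? : ∀ v e → Dec (_v⤳e_ G v e)
  v⤳e? v e = Fin.any? λ w → temporalWalkVia? e v w

  e⤳v? : ∀ e v → Dec (_e⤳v_ G e v)
  e⤳v? e v = Fin.any? λ u → temporalWalkVia? e u v

  -- Cutting and splicing temporal walks

  infixr 5 _▷_
  _▷_ : Walk u v → Walk v w → Walk u w
  empty      ▷ q = q
  step e j p ▷ q = step e j (p ▷ q)

  edges-▷ : (p : Walk u v) (q : Walk v w) → edges (p ▷ q) ≡ edges p ++ edges q
  edges-▷ empty        q = refl
  edges-▷ (step e _ p) q = cong (e ∷_) (edges-▷ p q)

  -- A temporal walk split at one traversal of `e`. The direction of the crossing is kept, and `xs`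
  -- and `ys` are the edges that must be remembered on either side.
  record Passage (xs : List Edge) (e : Edge) (ys : List Edge) (u v : Vertex) : Set where
    field
      {entry exit} : Vertex
      before       : Walk u entry
      crossing     : Joins e entry exit
      after        : Walk exit v
      before-incr  : Increasing (edges before)
      after-incr   : Increasing (edges after)
      before≺e     : All (_≺ e) (edges before)
      e≺after      : All (e ≺_) (edges after)
      xs⊆before    : xs ⊆ edges before
      ys⊆after     : ys ⊆ edges after

  open Passage

  edges-cut : Passage xs e ys u v → List Edge
  edges-cut {e = e} c = edges (before c) ++ e ∷ edges (after c)

  -- The list `xs′` is left free because `f` may be one of the remembered edges or one that is
  -- passed over.
  startWith : ∀ {xs′} → Joins f u w → (c : Passage xs e ys w v) → All (f ≺_) (edges-cut c) →
    xs′ ⊆ f ∷ edges (before c) → Passage xs′ e ys u v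
  startWith j c f≺c s = record
    { before = step _ j (before c) ; crossing = crossing c ; after = after c
    ; before-incr = All.++⁻ˡ (edges (before c)) f≺c ∷ before-incr c ; after-incr = after-incr c
    ; before≺e = All.head (All.++⁻ʳ (edges (before c)) f≺c) ∷ before≺e c ; e≺after = e≺after c
    ; xs⊆before = s ; ys⊆after = ys⊆after c }

  -- The equation lets the comparison of a new first edge with the whole rest of the walk be
  -- transferred to the pieces of the cut.
  cut : (p : Walk u v) → Increasing (edges p) → (xs ++ e ∷ ys) ⊆ edges p →
    ∃ λ (c : Passage xs e ys u v) → edges p ≡ edges-cut c
  cut {xs = []} empty _ ()
  cut {xs = _ ∷ _} empty _ ()
  cut {xs = []} (step e j p) (e≺p ∷ p-incr) (refl ∷ s) = record
    { before = empty ; crossing = j ; after = p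
    ; before-incr = [] ; after-incr = p-incr ; before≺e = [] ; e≺after = e≺p
    ; xs⊆before = [] ; ys⊆after = s } , refl
  cut {xs = x ∷ xs} (step x j p) (x≺p ∷ p-incr) (refl ∷ s) with c , eq ← cut {xs = xs} p p-incr s =
    startWith j c (subst (All (x ≺_)) eq x≺p) (refl ∷ xs⊆before c) , cong (x ∷_) eq
  cut (step x j p) (x≺p ∷ p-incr) (.x ∷ʳ s) with c , eq ← cut p p-incr s =
    startWith j c (subst (All (x ≺_)) eq x≺p) (x ∷ʳ xs⊆before c) , cong (x ∷_) eq

  passage : (p : Walk u v) → Temporal G p → (xs ++ e ∷ ys) ⊆ edges p → Passage xs e ys u v
  passage p temporal s = proj₁ (cut p (increasing {p = p} temporal) s)

  -- The label of `e` separates the two lists even though `e` itself is left out.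
  increasing-++ : Increasing xs → All (_≺ e) xs → Increasing ys → All (e ≺_) ys →
    Increasing (xs ++ ys)
  increasing-++ xs-incr xs≺e ys-incr e≺ys =
    AllPairs.++⁺ xs-incr ys-incr (All.map (λ x≺e → All.map (ℕ.<-trans x≺e) e≺ys) xs≺e)

  meet : Joins e u v → Joins e w x → u ≡ w × v ≡ x ⊎ u ≡ x × v ≡ w
  meet (inj₁ refl) (inj₁ refl) = inj₁ (refl , refl)
  meet (inj₁ refl) (inj₂ refl) = inj₂ (refl , refl)
  meet (inj₂ refl) (inj₁ refl) = inj₂ (refl , refl)
  meet (inj₂ refl) (inj₂ refl) = inj₁ (refl , refl)

  -- If the second passage leaves e at the vertex where the first one arrives at it,
  -- e has to be left out.
  splice : ∀ {zs zs′} → Passage xs e zs u w → Passage zs′ e ys x v →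
    ∃ λ (p : Walk u v) → Temporal G p × (xs ++ ys) ⊆ edges p
  splice {e = e} c d with meet (crossing c) (crossing d)
  ... | inj₁ (refl , refl) = p ,
    AllPairs⇒Linked (subst Increasing (sym eq)
      (AllPairs.++⁺ (before-incr c) (e≺after d ∷ after-incr d)
        (All.map (λ x≺e → x≺e ∷ All.map (ℕ.<-trans x≺e) (e≺after d)) (before≺e c)))) ,
    ⊆-trans (++⁺ (xs⊆before c) (e ∷ʳ ys⊆after d)) (⊆-reflexive (sym eq))
    where
    p = before c ▷ step e (crossing d) (after d)
    eq = edges-▷ (before c) (step e (crossing d) (after d))
  ... | inj₂ (refl , refl) = p ,
    AllPairs⇒Linked (subst Increasing (sym eq)
      (increasing-++ (before-incr c) (before≺e c) (after-incr d) (e≺after d))) ,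
    ⊆-trans (++⁺ (xs⊆before c) (ys⊆after d)) (⊆-reflexive (sym eq))
    where
    p = before c ▷ after d
    eq = edges-▷ (before c) (after d)

  -- This makes the descents through source edges and div-sink edges terminate.
  e⤳e⇒≺ : e ≢ e′ → _e⤳e_ G e e′ → e ≺ e′
  e⤳e⇒≺ e≢e′ (inj₁ e≡e′) = contradiction e≡e′ e≢e′
  e⤳e⇒≺ e≢e′ (inj₂ (_ , _ , p , temporal , s)) =
    All.lookup (e≺after c) (to∈ (ys⊆after c))
    where c = passage {xs = []} p temporal s

  -- Splicing at `e` keeps what follows `e` on the second walk, in particular `e′`, whether or not
  -- `e` survives.
  v⤳e⤳e : _v⤳e_ G v e → _e⤳e_ G e e′ → _v⤳e_ G v e′
  v⤳e⤳e v↝e (inj₁ refl) = v↝e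
  v⤳e⤳e (_ , p , p-temporal , e∈p) (inj₂ (_ , _ , q , q-temporal , s))
    with r , r-temporal , e′∈r ← splice (passage {xs = []} p p-temporal (from∈ e∈p))
                                        (passage {xs = []} q q-temporal s)
    = _ , r , r-temporal , to∈ e′∈r

  e⤳e⤳v : _e⤳e_ G e′ e → _e⤳v_ G e v → _e⤳v_ G e′ v
  e⤳e⤳v (inj₁ refl) e↝v = e↝v
  e⤳e⤳v {e′ = e′} (inj₂ (_ , _ , q , q-temporal , s)) (_ , p , p-temporal , e∈p)
    with r , r-temporal , e′∈r ← splice (passage {xs = e′ ∷ []} q q-temporal s)
                                        (passage {xs = []} p p-temporal (from∈ e∈p))
    = _ , r , r-temporal , to∈ e′∈r

  isEndpointOf⇒v⤳e : v isEndpointOf e → _v⤳e_ G v e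
  isEndpointOf⇒v⤳e (u , j) = u , step _ (swap j) empty , [-] , here refl

  isEndpointOf⇒e⤳v : v isEndpointOf e → _e⤳v_ G e v
  isEndpointOf⇒e⤳v (u , j) = u , step _ j empty , [-] , here refl

  -- First and last edges at a vertex

  FirstAt : Vertex → Edge → Set
  FirstAt v f = v isEndpointOf f × (∀ {e} → v isEndpointOf e → label f ≤ label e)

  LastAt : Vertex → Edge → Set
  LastAt v f = v isEndpointOf f × (∀ {e} → v isEndpointOf e → label e ≤ label f)

  -- Prepending `f` moves the start to its other end, which `e⤳v` permits since it leaves the start
  -- free.
  first⤳ : FirstAt v f → _v⤳v_ G v w → _e⤳v_ G f w
  first⤳ (v∈f , _) (empty , _) = isEndpointOf⇒e⤳v v∈f
  first⤳ {f = f} ((_ , j) , first) (p@(step g k _) , temporal) with f Fin.≟ g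
  ... | yes refl = _ , p , temporal , here refl
  ... | no f≢g   = _ , step f j p , ≤∧≢⇒≺ (_ , j) v∈g (first v∈g) f≢g ∷ temporal , here refl
    where v∈g = _ , swap k

  -- Only the final edge is compared with `f` directly, at `v`; the earlier edges inherit the bound
  -- because labels increase.
  endsWith⊎≺ : LastAt v f → (p : Walk u v) → Temporal G p →
    (∃[ xs ] edges p ≡ xs ++ f ∷ []) ⊎ All (_≺ f) (edges p)
  endsWith⊎≺ _ empty _ = inj₂ []
  endsWith⊎≺ {f = f} (v∈f , last) (step g j empty) _ with g Fin.≟ f
  ... | yes refl = inj₁ ([] , refl)
  ... | no g≢f   = inj₂ (≤∧≢⇒≺ (_ , j) v∈f (last (_ , j)) g≢f ∷ [])
  endsWith⊎≺ last (step g _ p@(step _ _ _)) (g≺h ∷ temporal) with endsWith⊎≺ last p temporal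
  ... | inj₁ (xs , eq)     = inj₁ (g ∷ xs , cong (g ∷_) eq)
  ... | inj₂ (h≺f ∷ p≺f) = inj₂ (ℕ.<-trans g≺h h≺f ∷ h≺f ∷ p≺f)

  extend-to-last : LastAt v f → (p : Walk u v) → Temporal G p →
    ∃[ w ] ∃ λ (q : Walk u w) → Temporal G q × ∃[ xs ] (edges q ≡ xs ++ f ∷ []) × edges p ⊆ edges q
  extend-to-last {f = f} last@((_ , j) , _) p temporal with endsWith⊎≺ last p temporal
  ... | inj₁ ends = _ , p , temporal , proj₁ ends , proj₂ ends , ⊆-refl
  ... | inj₂ p≺f  = _ , q ,
    AllPairs⇒Linked (subst Increasing (sym eq)
      (AllPairs.++⁺ (increasing {p = p} temporal) ([] ∷ []) (All.map (_∷ []) p≺f))) ,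
    edges p , eq , ⊆-trans (++⁺ʳ _ ⊆-refl) (⊆-reflexive (sym eq))
    where
    q = p ▷ step f (swap j) empty
    eq = edges-▷ p (step f (swap j) empty)

  ⤳last : LastAt v f → _v⤳v_ G u v → _v⤳e_ G u f
  ⤳last last (p , temporal) with _ , q , q-temporal , xs , eq , _ ← extend-to-last last p temporal
    = _ , q , q-temporal , subst (_ ∈_) (sym eq) (⊆-lookup (++⁺ˡ xs ⊆-refl) (here refl))

  e⤳last : LastAt v f → _e⤳v_ G e v → _e⤳e_ G e f
  e⤳last {f = f} last (_ , p , temporal , e∈p)
    with _ , q , q-temporal , xs , eq , p⊆q ← extend-to-last last p temporal
    -- Either `e` lies before the final `f`, or it is that `f` and the reflexive case applies.
    with ∈-++⁻ xs (subst (_ ∈_) eq (⊆-lookup p⊆q e∈p))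
  ... | inj₁ e∈xs        = inj₂ (_ , _ , q , q-temporal ,
    ⊆-trans (++⁺ (from∈ e∈xs) (⊆-refl {x = f ∷ []})) (⊆-reflexive (sym eq)))
  ... | inj₂ (here refl) = inj₁ refl

  module _ (connected : TemporallyConnected G) where

    -- Consequences of temporal connectivity

    -- The given edge rules out a single vertex without edges: a walk from `v` to one of its
    -- endpoints either is empty, so that `v` is this endpoint, or starts with an edge at `v`.
    incident : Edge → ∀ v → ∃ (v isEndpointOf_)
    incident e v with connected v (proj₁ (endpoints e))
    ... | empty , _      = e , _ , inj₂ refl
    ... | step g j _ , _ = g , _ , swap j

    firstAt : Edge → ∀ v → ∃ (FirstAt v)
    firstAt e v = minimiser (isEndpointOf? v) label (incident e v)

    lastAt : Edge → ∀ v → ∃ (LastAt v)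
    lastAt e v = maximiser (isEndpointOf? v) label (incident e v)

    firstAt⇒source : FirstAt v f → Source G f
    firstAt⇒source {v} first w = first⤳ first (connected v w)

    lastAt⇒divSink : LastAt v f → DivSink G f
    lastAt⇒divSink {v} last =
      (λ u → ⤳last last (connected u v)) ,
      (λ d (source , _) → e⤳last last (source v))

    divergent!⇒sink : ((d , _) : ∃! _≡_ (Divergent G)) → Sink G d
    divergent!⇒sink (d , _ , unique) v with f , first ← firstAt d v =
      decidable-stable (v⤳e? v d)
        (¬¬-minimal {Q = λ e → Source G e × _v⤳e_ G v e} ≺-noetherian
          (λ {e} (source , v↝e) latest →
            subst (_v⤳e_ G v) (sym (unique (source ,
              -- A further source edge reached from `e` would be reached from `v` too, with a larger
              -- label; so `e` is divergent and equals `d`.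
              λ (e′ , source′ , e′≢e , e↝e′) →
                latest (e′ , (source′ , v⤳e⤳e v↝e e↝e′) , e⤳e⇒≺ (e′≢e ∘ sym) e↝e′)))) v↝e)
          (firstAt⇒source first , isEndpointOf⇒v⤳e (proj₁ first)))

    convergent!⇒source : ((c , _) : ∃! _≡_ (Convergent G)) → Source G c
    convergent!⇒source (c , _ , unique) v with f , last ← lastAt c v =
      decidable-stable (e⤳v? c v)
        (¬¬-minimal {Q = λ e → DivSink G e × _e⤳v_ G e v} ≺-wellFounded
          (λ {e} (divSink , e↝v) earliest →
            subst (λ e → _e⤳v_ G e v) (sym (unique (divSink ,
              λ (e′ , divSink′ , e′≢e , e′↝e) →
                earliest (e′ , (divSink′ , e⤳e⤳v e′↝e e↝v) , e⤳e⇒≺ e′≢e e′↝e)))) e↝v)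
          (lastAt⇒divSink last , isEndpointOf⇒e⤳v (proj₁ last)))

lemma3p31 : (G : HappyTemporalGraph) → Compressed G → TemporallyConnected G →
    ((d! : ∃! _≡_ (Divergent G)) → Pivot G (proj₁ d!)) ×
    ((c! : ∃! _≡_ (Convergent G)) → Pivot G (proj₁ c!))
-- A divergent edge is a source and a convergent edge a sink by definition, so only the opposite
-- halves need the descents.
lemma3p31 G _ connected =
  (λ d! → proj₁ (proj₁ (proj₂ d!)) , divergent!⇒sink G connected d!) ,
  (λ c! → convergent!⇒source G connected c! , proj₁ (proj₁ (proj₁ (proj₂ c!))))
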